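{- Let $n\ge 1$ and $k$ be integers with $\lfloor n/2\rfloor \le k\le \lfloor (2n-2)/3\rfloor$. Then $\Phi^n_k$ is a median graph.
   Context: A subword of a word is a block of consecutive letters. A binary word (over $\{0,1\}$) of length $n\ge 1$ is Padovan if it starts and ends with $0$, contains no subword $00$, and contains no subword $111$. For $n\ge1$ and $\lfloor n/2\rfloor\le k\le\lfloor(2n-2)/3\rfloor$, the weighted Padovan graph $\Phi^n_k$ is the simple graph whose vertices are all Padovan words of length $n$ with exactly $k$ letters $1$; two vertices are adjacent if one can be obtained from the other by replacing exactly one subword $01$ with $10$. A graph $G$ is a median graph if for every triple of vertices $u,v,w$ of $G$ there exists a unique vertex which lies on a shortest $u,v$-path, on a shortest $u,w$-path, and on a shortest $v,w$-path. -}

module Defs where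

open import Data.Fin using (Fin; _≟_)
open import Data.Fin.Patterns using (0F; 1F)
open import Data.List using (List; []; _∷_; _++_; [_]; length; filter; head; last)
open import Data.List.Membership.Propositional using (_∈_)
open import Data.List.Properties using (∷-injective)
open import Data.List.Relation.Binary.Infix.Heterogeneous using (Infix)
open import Data.List.Relation.Unary.Unique.Propositional using (Unique)
open import Data.Maybe using (just)
open import Data.Nat using (ℕ; zero; suc; _≤_)
open import Data.Product using (Σ-syntax; ∃-syntax; ∃!; _×_; _,_; proj₂)
open import Data.Refinement using (Refinement-syntax; value)
open import Data.Sum using (_⊎_; inj₁; inj₂; swap)
open import Relation.Binary.Construct.Closure.ReflexiveTransitive using (Star; ε; _◅_)
open import Relation.Binary.Core using (Rel)
open import Relation.Binary.Definitions using (Symmetric; Irreflexive)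
open import Relation.Binary.PropositionalEquality using (_≡_; refl; sym; trans)
open import Relation.Nullary using (¬_)

record SimpleGraph : Set₁ where
  field
    Vertex     : Set
    Adj        : Rel Vertex _
    adj-sym    : Symmetric Adj
    adj-irrefl : Irreflexive _≡_ Adj

module _ (G : SimpleGraph) where
  open SimpleGraph G

  Walk : Rel Vertex _
  Walk = Star Adj

  vertices : ∀ {u v} → Walk u v → List Vertex
  vertices {u} ε       = [ u ]
  vertices {u} (_ ◅ p) = u ∷ vertices p

  edgeCount : ∀ {u v} → Walk u v → ℕ
  edgeCount ε       = zero
  edgeCount (_ ◅ p) = suc (edgeCount p)

  IsPath : ∀ {u v} → Walk u v → Set
  IsPath p = Unique (vertices p)

  IsShortestPath : ∀ {u v} → Walk u v → Set
  IsShortestPath {u} {v} p =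
    IsPath p × ((q : Walk u v) → IsPath q → edgeCount p ≤ edgeCount q)

  OnShortestPath : Vertex → Vertex → Vertex → Set
  OnShortestPath u v x = Σ[ p ∈ Walk u v ] IsShortestPath p × x ∈ vertices p

  IsMedianGraph : Set
  IsMedianGraph = ∀ (u v w : Vertex) →
    ∃! _≡_ λ x → OnShortestPath u v x × OnShortestPath u w x × OnShortestPath v w x

Word : Set
Word = List (Fin 2)

IsSubword : Rel Word _
IsSubword = Infix _≡_

record IsPadovan (w : Word) : Set where
  field
    starts-with-0 : head w ≡ just 0F
    ends-with-0   : last w ≡ just 0F
    no-00         : ¬ IsSubword (0F ∷ 0F ∷ []) w
    no-111        : ¬ IsSubword (1F ∷ 1F ∷ 1F ∷ []) w

ones : Word → ℕ
ones w = length (filter (_≟ 1F) w)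

Swaps01To10 : Rel Word _
Swaps01To10 u v = ∃[ p ] ∃[ s ] u ≡ p ++ 0F ∷ 1F ∷ s × v ≡ p ++ 1F ∷ 0F ∷ s

swap-irrefl : Irreflexive _≡_ Swaps01To10
swap-irrefl refl (p , s , e , e′) = go p (trans (sym e) e′)
  where
  go : ∀ p → ¬ (p ++ 0F ∷ 1F ∷ s ≡ p ++ 1F ∷ 0F ∷ s)
  go []      ()
  go (_ ∷ p) eq = go p (proj₂ (∷-injective eq))

-- The defining property of a vertex is carried proof-irrelevantly, so equality
-- of vertices is equality of the underlying words.
PadovanWord : ℕ → ℕ → Set
PadovanWord n k = [ w ∈ Word ∣ IsPadovan w × length w ≡ n × ones w ≡ k ]

Φ : ℕ → ℕ → SimpleGraph
Φ n k = record
  { Vertex     = PadovanWord n k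
  ; Adj        = λ u v → Swaps01To10 (value u) (value v) ⊎ Swaps01To10 (value v) (value u)
  ; adj-sym    = swap
  ; adj-irrefl = λ { refl (inj₁ s) → swap-irrefl refl s ; refl (inj₂ s) → swap-irrefl refl s }
  }

{-# OPTIONS --safe #-}
-- A Padovan word is 0 1^a₁ 0 1^a₂ 0 … 1^aₘ 0 with every aᵢ ∈ {1 , 2}; reading 2 as true
-- and 1 as false, the words of Φ n k become all the Boolean vectors of length n ∸ suc k with
-- a fixed number of trues, and 01 ↦ 10 acts on these as false true ↦ true false. Such a
-- vector is determined by its prefix counts, the graph distance is the ℓ¹ distance of
-- prefix counts, and the coordinatewise median of three prefix counts is again one because its
-- increments stay in {0 , 1}.
module Submission where

open import Defs
open import Algebra.Properties.CommutativeSemigroup using (interchange)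
open import Data.Bool using (Bool; true; false)
open import Data.Fin using (_≟_)
open import Data.Fin.Patterns using (0F; 1F)
open import Data.Irrelevant as Irrelevant using ([_])
open import Data.List using ([]; _∷_; _++_; length; head; last; drop)
open import Data.List.Membership.Propositional using (_∈_)
open import Data.List.Properties using (∷-injectiveʳ; ≡-dec)
open import Data.List.Relation.Binary.Infix.Heterogeneous using (here; there)
open import Data.List.Relation.Binary.Prefix.Heterogeneous using ([]; _∷_)
open import Data.List.Relation.Unary.All using ([]; tabulate)
open import Data.List.Relation.Unary.AllPairs using ([]; _∷_)
open import Data.List.Relation.Unary.Any using (here; there)
open import Data.Maybe using (just)
open import Data.Nat
  using (ℕ; zero; suc; _+_; _*_; _∸_; _⊔_; _⊓_; ∣_-_∣; _≤_; _<_; z≤n; s≤s; s≤s⁻¹)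
open import Data.Nat.DivMod using (_/_)
open import Data.Nat.Properties renaming (_≟_ to _≟ℕ_)
open import Data.Product using (∃₂; ∃-syntax; _×_; _,_; proj₁; proj₂)
open import Data.Refinement using (_,_; value; proof; value-injective)
open import Data.Sum using (_⊎_; inj₁; inj₂)
open import Data.Vec using (Vec; []; _∷_; replicate)
open import Function using (case_of_)
open import Relation.Binary.Construct.Closure.ReflexiveTransitive using (ε; _◅_; _◅◅_)
open import Relation.Binary.PropositionalEquality
open import Relation.Nullary using (¬_; contradiction; recompute)

-- Shortest paths from a metric that can be decreased along edges.

-- These axioms force `d` to be the graph distance. `approach` lets either endpoint move because a
-- swap of 01 to 10 only raises prefix counts, so it is applied to the word that is lower where the
-- two first differ.
record GeodesicMetric (G : SimpleGraph) : Set where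
  open SimpleGraph G

  field
    d          : Vertex → Vertex → ℕ
    d-refl     : ∀ u → d u u ≡ 0
    d-sym      : ∀ u v → d u v ≡ d v u
    d-triangle : ∀ u v w → d u w ≤ d u v + d v w
    d-adj      : ∀ {u v} → Adj u v → d u v ≤ 1
    approach   : ∀ u v → u ≡ v
                       ⊎ (∃[ u′ ] Adj u u′ × d u v ≡ suc (d u′ v))
                       ⊎ (∃[ v′ ] Adj v v′ × d v u ≡ suc (d v′ u))

  edgeCount-◅◅ : ∀ {u v w} (p : Walk G u v) (q : Walk G v w) →
                 edgeCount G (p ◅◅ q) ≡ edgeCount G p + edgeCount G q
  edgeCount-◅◅ ε       q = refl
  edgeCount-◅◅ (_ ◅ p) q = cong suc (edgeCount-◅◅ p q)

  start∈vertices : ∀ {u v} (p : Walk G u v) → u ∈ vertices G p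
  start∈vertices ε       = here refl
  start∈vertices (_ ◅ p) = here refl

  junction∈vertices : ∀ {u v w} (p : Walk G u v) (q : Walk G v w) → v ∈ vertices G (p ◅◅ q)
  junction∈vertices ε       q = start∈vertices q
  junction∈vertices (_ ◅ p) q = there (junction∈vertices p q)

  d-step : ∀ {u v} → Adj u v → ∀ w → d u w ≤ suc (d v w)
  d-step {u} {v} e w = ≤-trans (d-triangle u v w) (+-monoˡ-≤ (d v w) (d-adj e))

  d≤edgeCount : ∀ {u v} (p : Walk G u v) → d u v ≤ edgeCount G p
  d≤edgeCount {u} ε           = ≤-reflexive (d-refl u)
  d≤edgeCount {v = v} (e ◅ p) = ≤-trans (d-step e v) (s≤s (d≤edgeCount p))

  -- Each edge before `x` lowers the distance to `x` by at most one. The bound serves both to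
  -- exclude repeated vertices and to turn shortest paths into metric betweenness.
  d-via≤edgeCount : ∀ {u v x} (p : Walk G u v) → x ∈ vertices G p →
                    d u x + d x v ≤ edgeCount G p
  d-via≤edgeCount {u} ε (here refl) =
    ≤-reflexive (cong₂ _+_ (d-refl u) (d-refl u))
  d-via≤edgeCount {u} {v} p@(_ ◅ _) (here refl) =
    ≤-trans (≤-reflexive (cong (_+ d u v) (d-refl u))) (d≤edgeCount p)
  d-via≤edgeCount {v = v} {x} (e ◅ p) (there x∈p) =
    ≤-trans (+-monoˡ-≤ (d x v) (d-step e x)) (s≤s (d-via≤edgeCount p x∈p))

  tight⇒isPath : ∀ {u v} (p : Walk G u v) → edgeCount G p ≤ d u v → IsPath G p
  tight⇒isPath ε _ = [] ∷ []
  tight⇒isPath {u} {v} (e ◅ p) p≤d =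
    -- If `u` occurred again in `p`, then `p` alone would have at least `d u v` edges, and the walk
    -- with `e` too many.
    tabulate (λ { x∈p refl → <⇒≱ p≤d (≤-trans (m≤n+m (d u v) _) (d-via≤edgeCount p x∈p)) })
    ∷ tight⇒isPath p (s≤s⁻¹ (≤-trans p≤d (d-step e v)))

  geodesic : ∀ N u v → d u v ≡ N → ∃[ p ] edgeCount G {u} {v} p ≡ N
  geodesic N u v duv≡N with approach u v
  geodesic N u .u duu≡N | inj₁ refl = ε , trans (sym (d-refl u)) duu≡N
  geodesic zero u v duv≡N | inj₂ (inj₁ (_ , _ , eq)) = contradiction (trans (sym eq) duv≡N) λ ()
  geodesic (suc N) u v duv≡N | inj₂ (inj₁ (u′ , e , eq))
    with p , p≡N ← geodesic N u′ v (suc-injective (trans (sym eq) duv≡N)) = e ◅ p , cong suc p≡N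
  geodesic zero u v duv≡N | inj₂ (inj₂ (_ , _ , eq)) =
    contradiction (trans (sym eq) (trans (d-sym v u) duv≡N)) λ ()
  -- The target has moved, so the edge is reversed and appended at the far end.
  geodesic (suc N) u v duv≡N | inj₂ (inj₂ (v′ , e , eq))
    with p , p≡N ← geodesic N u v′ (suc-injective (trans (cong suc (d-sym u v′))
                                     (trans (sym eq) (trans (d-sym v u) duv≡N)))) =
    p ◅◅ (adj-sym e ◅ ε) ,
    trans (edgeCount-◅◅ p _) (trans (+-comm _ 1) (cong suc p≡N))

  onShortestPath⇒between : ∀ {u v x} → OnShortestPath G u v x → d u x + d x v ≡ d u v
  onShortestPath⇒between {u} {v} {x} (p , (_ , shortest) , x∈p)
    with q , q≡d ← geodesic _ u v refl =
    ≤-antisym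
      (≤-trans (d-via≤edgeCount p x∈p)
        (≤-trans (shortest q (tight⇒isPath q (≤-reflexive q≡d))) (≤-reflexive q≡d)))
      (d-triangle u x v)

  between⇒onShortestPath : ∀ {u v x} → d u x + d x v ≡ d u v → OnShortestPath G u v x
  between⇒onShortestPath {u} {v} {x} eq
    with p , p≡d ← geodesic _ u x refl | q , q≡d ← geodesic _ x v refl =
    p ◅◅ q , (tight⇒isPath (p ◅◅ q) tight , λ r _ → ≤-trans tight (d≤edgeCount r)) ,
    junction∈vertices p q
    where
    tight : edgeCount G (p ◅◅ q) ≤ d u v
    tight = ≤-reflexive (trans (edgeCount-◅◅ p q) (trans (cong₂ _+_ p≡d q≡d) eq))

-- Betweenness and medians of natural numbers.

m≤n⊔o⇒m≤n∨m≤o : ∀ {m} n o → m ≤ n ⊔ o → m ≤ n ⊎ m ≤ o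
m≤n⊔o⇒m≤n∨m≤o n o m≤n⊔o with ⊔-sel n o
... | inj₁ eq = inj₁ (≤-trans m≤n⊔o (≤-reflexive eq))
... | inj₂ eq = inj₂ (≤-trans m≤n⊔o (≤-reflexive eq))

Between : ℕ → ℕ → ℕ → Set
Between a x b = ∣ a - x ∣ + ∣ x - b ∣ ≡ ∣ a - b ∣

bounds⇒between : ∀ a x b → a ⊓ b ≤ x → x ≤ a ⊔ b → Between a x b
bounds⇒between zero    x       b       _ x≤b = trans (+-comm x _) (trans
  (cong (_+ x) (trans (∣-∣-comm x b) (m≤n⇒∣n-m∣≡n∸m x≤b))) (m∸n+n≡m x≤b))
bounds⇒between (suc a) x       zero    _ x≤a = trans
  (cong₂ _+_ (m≤n⇒∣n-m∣≡n∸m x≤a) (∣-∣-identityʳ x)) (m∸n+n≡m x≤a)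
bounds⇒between (suc a) (suc x) (suc b) (s≤s l) (s≤s h) = bounds⇒between a x b l h

between⇒bounds : ∀ a x b → Between a x b → a ⊓ b ≤ x × x ≤ a ⊔ b
between⇒bounds zero    x       b       eq = z≤n , m+n≤o⇒m≤o x (≤-reflexive eq)
between⇒bounds (suc a) x       zero    eq =
  z≤n , subst (_≤ suc a) (∣-∣-identityʳ x) (m+n≤o⇒n≤o _ (≤-reflexive eq))
between⇒bounds (suc a) zero    (suc b) eq = contradiction (≤-reflexive eq)
  (<⇒≱ (s≤s (≤-trans (∣m-n∣≤m⊔n a b) (≤-trans (m⊔n≤m+n a b) (+-monoʳ-≤ a (n≤1+n b))))))
between⇒bounds (suc a) (suc x) (suc b) eq with l , h ← between⇒bounds a x b eq = s≤s l , s≤s h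

-- The middle one of three numbers. Lattice operations alone make it monotone and let it commute
-- with `suc` by computation.
med : ℕ → ℕ → ℕ → ℕ
med a b c = (a ⊔ b) ⊓ ((a ⊔ c) ⊓ (b ⊔ c))

med-idem : ∀ a → med a a a ≡ a
med-idem a rewrite ⊔-idem a | ⊓-idem a = ⊓-idem a

med-mono-≤ : ∀ {a a′ b b′ c c′} → a ≤ a′ → b ≤ b′ → c ≤ c′ → med a b c ≤ med a′ b′ c′
med-mono-≤ a≤ b≤ c≤ = ⊓-mono-≤ (⊔-mono-≤ a≤ b≤) (⊓-mono-≤ (⊔-mono-≤ a≤ c≤) (⊔-mono-≤ b≤ c≤))

med-between₁₂ : ∀ a b c → Between a (med a b c) b
med-between₁₂ a b c = bounds⇒between a _ b
  (⊓-glb (≤-trans a⊓b≤a (m≤m⊔n a b))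
    (⊓-glb (≤-trans a⊓b≤a (m≤m⊔n a c)) (≤-trans (m⊓n≤n a b) (m≤m⊔n b c))))
  (m⊓n≤m _ _)
  where a⊓b≤a = m⊓n≤m a b

med-between₁₃ : ∀ a b c → Between a (med a b c) c
med-between₁₃ a b c = bounds⇒between a _ c
  (⊓-glb (≤-trans a⊓c≤a (m≤m⊔n a b))
    (⊓-glb (≤-trans a⊓c≤a (m≤m⊔n a c)) (≤-trans (m⊓n≤n a c) (m≤n⊔m b c))))
  (≤-trans (m⊓n≤n (a ⊔ b) _) (m⊓n≤m _ _))
  where a⊓c≤a = m⊓n≤m a c

med-between₂₃ : ∀ a b c → Between b (med a b c) c
med-between₂₃ a b c = bounds⇒between b _ c
  (⊓-glb (≤-trans b⊓c≤b (m≤n⊔m a b))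
    (⊓-glb (≤-trans (m⊓n≤n b c) (m≤n⊔m a c)) (≤-trans b⊓c≤b (m≤m⊔n b c))))
  (≤-trans (m⊓n≤n (a ⊔ b) _) (m⊓n≤n (a ⊔ c) _))
  where b⊓c≤b = m⊓n≤m b c

IsMedian : ℕ → ℕ → ℕ → ℕ → Set
IsMedian a b c x = Between a x b × Between a x c × Between b x c

med-isMedian : ∀ a b c → IsMedian a b c (med a b c)
med-isMedian a b c = med-between₁₂ a b c , med-between₁₃ a b c , med-between₂₃ a b c

-- The upper bounds place `x` below two of `a`, `b`, `c`, and the minimum of those two is a lower
-- bound for `y`. Exchanging `x` and `y` gives uniqueness.
medians-≤ : ∀ a b c x y → IsMedian a b c x → IsMedian a b c y → x ≤ y
medians-≤ a b c x y (axb , axc , bxc) (ayb , ayc , byc) =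
  case m≤n⊔o⇒m≤n∨m≤o a b (upper a b axb) of λ where
    (inj₁ x≤a) → case m≤n⊔o⇒m≤n∨m≤o b c (upper b c bxc) of λ where
      (inj₁ x≤b) → ≤-trans (⊓-glb x≤a x≤b) (lower a b ayb)
      (inj₂ x≤c) → ≤-trans (⊓-glb x≤a x≤c) (lower a c ayc)
    (inj₂ x≤b) → case m≤n⊔o⇒m≤n∨m≤o a c (upper a c axc) of λ where
      (inj₁ x≤a) → ≤-trans (⊓-glb x≤a x≤b) (lower a b ayb)
      (inj₂ x≤c) → ≤-trans (⊓-glb x≤b x≤c) (lower b c byc)
  where
  upper : ∀ a b → Between a x b → x ≤ a ⊔ b
  upper a b = λ eq → proj₂ (between⇒bounds a x b eq)
  lower : ∀ a b → Between a y b → a ⊓ b ≤ y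
  lower a b = λ eq → proj₁ (between⇒bounds a y b eq)

-- Lattice paths and the ℓ¹ distance of their heights.

rise : Bool → ℕ → ℕ
rise true  p = suc p
rise false p = p

≤-rise : ∀ b p → p ≤ rise b p
≤-rise true  p = n≤1+n p
≤-rise false p = ≤-refl

rise-≤-suc : ∀ b p → rise b p ≤ suc p
rise-≤-suc true  p = ≤-refl
rise-≤-suc false p = n≤1+n p

rise-injective : ∀ b c p → rise b p ≡ rise c p → b ≡ c
rise-injective true  true  p eq = refl
rise-injective true  false p eq = contradiction eq 1+n≢n
rise-injective false true  p eq = contradiction (sym eq) 1+n≢n
rise-injective false false p eq = refl

rise-reaches : ∀ {p q} → p ≤ q → q ≤ suc p → ∃[ b ] rise b p ≡ q
rise-reaches p≤q q≤1+p with m≤n⇒m<n∨m≡n p≤q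
... | inj₁ p<q = true  , ≤-antisym p<q q≤1+p
... | inj₂ p≡q = false , p≡q

-- A vector is read as a lattice path; the numeric arguments below are starting heights.
end : ∀ {m} → ℕ → Vec Bool m → ℕ
end p []      = p
end p (b ∷ u) = end (rise b p) u

dist : ∀ {m} → ℕ → ℕ → Vec Bool m → Vec Bool m → ℕ
dist p q []      []      = 0
dist p q (a ∷ u) (b ∷ v) = ∣ rise a p - rise b q ∣ + dist (rise a p) (rise b q) u v

dist-refl : ∀ {m} p (u : Vec Bool m) → dist p p u u ≡ 0
dist-refl p []      = refl
dist-refl p (b ∷ u) = cong₂ _+_ (∣n-n∣≡0 (rise b p)) (dist-refl (rise b p) u)

dist-sym : ∀ {m} p q (u v : Vec Bool m) → dist p q u v ≡ dist q p v u
dist-sym p q []      []      = refl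
dist-sym p q (a ∷ u) (b ∷ v) =
  cong₂ _+_ (∣-∣-comm (rise a p) (rise b q)) (dist-sym (rise a p) (rise b q) u v)

+-interchange = interchange +-commutativeSemigroup

dist-triangle : ∀ {m} p q r (u v w : Vec Bool m) → dist p r u w ≤ dist p q u v + dist q r v w
dist-triangle p q r []      []      []      = z≤n
dist-triangle p q r (a ∷ u) (b ∷ v) (c ∷ w) = ≤-trans
  (+-mono-≤ (∣-∣-triangle p′ q′ r′) (dist-triangle p′ q′ r′ u v w))
  (≤-reflexive (+-interchange ∣ p′ - q′ ∣ ∣ q′ - r′ ∣ _ _))
  where
  p′ = rise a p
  q′ = rise b q
  r′ = rise c r

-- Betweenness and medians of lattice paths.

BetweenPaths : ∀ {m} → ℕ → ℕ → ℕ → Vec Bool m → Vec Bool m → Vec Bool m → Set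
BetweenPaths p s q u x v = dist p s u x + dist s q x v ≡ dist p q u v

betweenPaths-∷ : ∀ {m} p s q a c b (u x v : Vec Bool m) →
  Between (rise a p) (rise c s) (rise b q) →
  BetweenPaths (rise a p) (rise c s) (rise b q) u x v →
  BetweenPaths p s q (a ∷ u) (c ∷ x) (b ∷ v)
betweenPaths-∷ p s q a c b u x v h t =
  trans (+-interchange ∣ rise a p - rise c s ∣ _ _ _) (cong₂ _+_ h t)

-- Applied to the triangle inequalities for the first height and for the remaining path, this
-- reduces betweenness of paths to betweenness at each height.
+-tight : ∀ {a b c d} → a ≤ b → c ≤ d → b + d ≡ a + c → b ≡ a × d ≡ c
+-tight {a} {b} {c} {d} a≤b c≤d eq =
  ≤-antisym (+-cancelʳ-≤ d b a (≤-trans (≤-reflexive eq) (+-monoʳ-≤ a c≤d))) a≤b ,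
  ≤-antisym (+-cancelˡ-≤ b d c (≤-trans (≤-reflexive eq) (+-monoˡ-≤ c a≤b))) c≤d

betweenPaths-uncons : ∀ {m} p s q a c b (u x v : Vec Bool m) →
  BetweenPaths p s q (a ∷ u) (c ∷ x) (b ∷ v) →
  Between (rise a p) (rise c s) (rise b q) ×
  BetweenPaths (rise a p) (rise c s) (rise b q) u x v
betweenPaths-uncons p s q a c b u x v eq = +-tight
  (∣-∣-triangle (rise a p) (rise c s) (rise b q))
  (dist-triangle (rise a p) (rise c s) (rise b q) u x v)
  (trans (+-interchange ∣ rise a p - rise c s ∣ ∣ rise c s - rise b q ∣ _ _) eq)

IsMedianPath : ∀ {m} → ℕ → ℕ → ℕ → ℕ → (u v w x : Vec Bool m) → Set
IsMedianPath p q r s u v w x =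
  BetweenPaths p s q u x v × BetweenPaths p s r u x w × BetweenPaths q s r v x w

isMedianPath-∷ : ∀ {m} p q r s a b c i (u v w x : Vec Bool m) →
  IsMedian (rise a p) (rise b q) (rise c r) (rise i s) →
  IsMedianPath (rise a p) (rise b q) (rise c r) (rise i s) u v w x →
  IsMedianPath p q r s (a ∷ u) (b ∷ v) (c ∷ w) (i ∷ x)
isMedianPath-∷ p q r s a b c i u v w x (aib , aic , bic) (uxv , uxw , vxw) =
  betweenPaths-∷ p s q a i b u x v aib uxv ,
  betweenPaths-∷ p s r a i c u x w aic uxw ,
  betweenPaths-∷ q s r b i c v x w bic vxw

isMedianPath-uncons : ∀ {m} p q r s a b c i (u v w x : Vec Bool m) →
  IsMedianPath p q r s (a ∷ u) (b ∷ v) (c ∷ w) (i ∷ x) →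
  IsMedian (rise a p) (rise b q) (rise c r) (rise i s) ×
  IsMedianPath (rise a p) (rise b q) (rise c r) (rise i s) u v w x
isMedianPath-uncons p q r s a b c i u v w x (uxv , uxw , vxw)
  with aib , uxv′ ← betweenPaths-uncons p s q a i b u x v uxv
     | aic , uxw′ ← betweenPaths-uncons p s r a i c u x w uxw
     | bic , vxw′ ← betweenPaths-uncons q s r b i c v x w vxw =
  (aib , aic , bic) , (uxv′ , uxw′ , vxw′)

-- The running height is kept at the median of the three heights. The claim on `end` later shows
-- that the median of three codes is again the code of a vertex.
median-exists : ∀ {m} p q r (u v w : Vec Bool m) →
  ∃[ x ] IsMedianPath p q r (med p q r) u v w x
       × end (med p q r) x ≡ med (end p u) (end q v) (end r w)
median-exists p q r []      []      []      = [] , (refl , refl , refl) , refl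
median-exists p q r (a ∷ u) (b ∷ v) (c ∷ w)
  -- By monotonicity the next median lies between `med p q r` and `med (suc p) (suc q) (suc r)`,
  -- which computes to `suc (med p q r)`; one Boolean step reaches it.
  with i , i≡ ← rise-reaches
                  (med-mono-≤ (≤-rise a p) (≤-rise b q) (≤-rise c r))
                  (med-mono-≤ (rise-≤-suc a p) (rise-≤-suc b q) (rise-≤-suc c r))
     | x , x-median , x-end ← median-exists (rise a p) (rise b q) (rise c r) u v w =
  i ∷ x ,
  isMedianPath-∷ p q r (med p q r) a b c i u v w x
    (subst (IsMedian (rise a p) (rise b q) (rise c r)) (sym i≡)
      (med-isMedian (rise a p) (rise b q) (rise c r)))
    (subst (λ s → IsMedianPath (rise a p) (rise b q) (rise c r) s u v w x) (sym i≡) x-median) ,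
  trans (cong (λ s → end s x) i≡) x-end

median-unique : ∀ {m} p q r s (u v w x y : Vec Bool m) →
  IsMedianPath p q r s u v w x → IsMedianPath p q r s u v w y → x ≡ y
median-unique p q r s [] [] [] [] [] _ _ = refl
median-unique p q r s (a ∷ u) (b ∷ v) (c ∷ w) (i ∷ x) (j ∷ y) x-median y-median
  with i-median , x-median′ ← isMedianPath-uncons p q r s a b c i u v w x x-median
     | j-median , y-median′ ← isMedianPath-uncons p q r s a b c j u v w y y-median
  -- Both candidates stand at height `s` and the median height after one step is unique, so the
  -- first letters agree and the tails share a starting height.
  with refl ← rise-injective i j s
                (≤-antisym (medians-≤ (rise a p) (rise b q) (rise c r) _ _ i-median j-median)
                           (medians-≤ (rise a p) (rise b q) (rise c r) _ _ j-median i-median)) =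
  cong (i ∷_) (median-unique _ _ _ _ u v w x y x-median′ y-median′)

-- Elementary moves and descent of the distance.

infix 4 _⇝_

data _⇝_ : ∀ {m} → Vec Bool m → Vec Bool m → Set where
  here  : ∀ {m} {u : Vec Bool m} → false ∷ true ∷ u ⇝ true ∷ false ∷ u
  there : ∀ {m b} {u v : Vec Bool m} → u ⇝ v → b ∷ u ⇝ b ∷ v

⇝-end : ∀ {m} p {u v : Vec Bool m} → u ⇝ v → end p u ≡ end p v
⇝-end p here              = refl
⇝-end p (there {b = b} e) = ⇝-end (rise b p) e

p<q⇒∣p-q∣≡1+∣1+p-q∣ : ∀ {p q} → p < q → ∣ p - q ∣ ≡ suc ∣ suc p - q ∣
p<q⇒∣p-q∣≡1+∣1+p-q∣ {zero}  (s≤s z≤n)     = refl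
p<q⇒∣p-q∣≡1+∣1+p-q∣ {suc p} (s≤s p<q)     = p<q⇒∣p-q∣≡1+∣1+p-q∣ p<q

-- The paths differ only in the height between the two exchanged letters, and there by one.
⇝-dist : ∀ {m} p {u v : Vec Bool m} → u ⇝ v → dist p p u v ≡ 1
⇝-dist p (here {u = u})
  rewrite p<q⇒∣p-q∣≡1+∣1+p-q∣ (n<1+n p) | ∣n-n∣≡0 p | dist-refl (suc p) u = refl
⇝-dist p (there {b = b} e) rewrite ∣n-n∣≡0 (rise b p) = ⇝-dist (rise b p) e

-- The first true of u is moved one step to the left. Up to there the path of u has stayed flat,
-- so it is still strictly below the path of v.
raise : ∀ {m} p q b (u v : Vec Bool m) → p < rise b q → end p u ≡ end (rise b q) v →
        ∃[ u′ ] false ∷ u ⇝ u′ × dist p q (false ∷ u) (b ∷ v) ≡ suc (dist p q u′ (b ∷ v))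
raise p q b []          []      p<q eq = contradiction eq (<⇒≢ p<q)
raise p q b (true ∷ u)  (c ∷ v) p<q eq =
  true ∷ false ∷ u , here , cong (_+ dist p (rise b q) (true ∷ u) (c ∷ v)) (p<q⇒∣p-q∣≡1+∣1+p-q∣ p<q)
raise p q b (false ∷ u) (c ∷ v) p<q eq
  with u′ , e , closer ← raise p (rise b q) c u v (≤-trans p<q (≤-rise c (rise b q))) eq =
  false ∷ u′ , there e , trans (cong (∣ p - rise b q ∣ +_) closer) (+-suc _ _)

Closer : ∀ {m} → ℕ → Vec Bool m → Vec Bool m → Set
Closer p u v = ∃[ u′ ] u ⇝ u′ × dist p p u v ≡ suc (dist p p u′ v)

closer-∷ : ∀ {m} p b {u v : Vec Bool m} → Closer (rise b p) u v → Closer p (b ∷ u) (b ∷ v)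
closer-∷ p b (u′ , e , eq) =
  b ∷ u′ , there e , trans (cong (∣ rise b p - rise b p ∣ +_) eq) (+-suc _ _)

-- At the first differing letter the path with `false` falls below the other, and equal ends let
-- `raise` bring it closer.
≡-or-closer : ∀ {m} p (u v : Vec Bool m) → end p u ≡ end p v →
              u ≡ v ⊎ Closer p u v ⊎ Closer p v u
≡-or-closer p []          []          _  = inj₁ refl
≡-or-closer p (false ∷ u) (true ∷ v)  eq = inj₂ (inj₁ (raise p p true u v ≤-refl eq))
≡-or-closer p (true ∷ u)  (false ∷ v) eq = inj₂ (inj₂ (raise p p true v u ≤-refl (sym eq)))
≡-or-closer p (true ∷ u)  (true ∷ v)  eq with ≡-or-closer (suc p) u v eq
... | inj₁ refl     = inj₁ refl
... | inj₂ (inj₁ c) = inj₂ (inj₁ (closer-∷ p true c))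
... | inj₂ (inj₂ c) = inj₂ (inj₂ (closer-∷ p true c))
≡-or-closer p (false ∷ u) (false ∷ v) eq with ≡-or-closer p u v eq
... | inj₁ refl     = inj₁ refl
... | inj₂ (inj₁ c) = inj₂ (inj₁ (closer-∷ p false c))
... | inj₂ (inj₂ c) = inj₂ (inj₂ (closer-∷ p false c))

-- Padovan words as Boolean vectors.

-- The Padovan word coded by u is 0F ∷ runs u.
runs : ∀ {m} → Vec Bool m → Word
runs []          = []
runs (false ∷ u) = 1F ∷ 0F ∷ runs u
runs (true ∷ u)  = 1F ∷ 1F ∷ 0F ∷ runs u

-- Junk outside the image of runs.
unruns : ∀ m → Word → Vec Bool m
unruns zero    _                  = []
unruns (suc m) (1F ∷ 0F ∷ w)      = false ∷ unruns m w
unruns (suc m) (1F ∷ 1F ∷ 0F ∷ w) = true ∷ unruns m w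
unruns (suc m) _                  = replicate (suc m) false

unruns-runs : ∀ {m} (u : Vec Bool m) → unruns m (runs u) ≡ u
unruns-runs []          = refl
unruns-runs (false ∷ u) = cong (false ∷_) (unruns-runs u)
unruns-runs (true ∷ u)  = cong (true ∷_) (unruns-runs u)

runs-injective : ∀ {m} {u v : Vec Bool m} → runs u ≡ runs v → u ≡ v
runs-injective {m} {u} {v} eq =
  trans (sym (unruns-runs u)) (trans (cong (unruns m) eq) (unruns-runs v))

-- Every letter contributes one obligatory 1, and `end` counts the second 1 of each `true`. For a
-- fixed vector length, the number of ones thus determines the end height.
ones-runs : ∀ {m} p (u : Vec Bool m) → p + ones (runs u) ≡ m + end p u
ones-runs p []          = +-identityʳ p
ones-runs p (false ∷ u) = trans (+-suc p _) (cong suc (ones-runs p u))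
ones-runs p (true ∷ u)  =
  trans (+-suc p _) (cong suc (trans (+-suc p _) (ones-runs (suc p) u)))

-- There is one 0 per letter. With the leading 0 of the word, length `n` and `k` ones leave
-- `n ∸ suc k` letters.
length-runs : ∀ {m} (u : Vec Bool m) → length (runs u) ≡ m + ones (runs u)
length-runs []          = refl
length-runs {suc m} (false ∷ u) =
  cong suc (trans (cong suc (length-runs u)) (sym (+-suc m _)))
length-runs {suc m} (true ∷ u)  = cong suc (trans (cong (2 +_) (length-runs u))
  (sym (trans (+-suc m _) (cong suc (+-suc m _)))))

runs-padovan : ∀ {m} (u : Vec Bool m) → IsPadovan (0F ∷ runs u)
runs-padovan u = record
  { starts-with-0 = refl
  ; ends-with-0   = ends u
  ; no-00         = ¬00 u
  ; no-111        = ¬111 u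
  }
  where
  ends : ∀ {m} (u : Vec Bool m) → last (0F ∷ runs u) ≡ just 0F
  ends []          = refl
  ends (false ∷ u) = ends u
  ends (true ∷ u)  = ends u

  ¬00 : ∀ {m} (u : Vec Bool m) → ¬ IsSubword (0F ∷ 0F ∷ []) (0F ∷ runs u)
  ¬00 []          (here (_ ∷ ()))
  ¬00 []          (there (here ()))
  ¬00 (false ∷ u) (here (_ ∷ () ∷ _))
  ¬00 (false ∷ u) (there (here (() ∷ _)))
  ¬00 (false ∷ u) (there (there i)) = ¬00 u i
  ¬00 (true ∷ u)  (here (_ ∷ () ∷ _))
  ¬00 (true ∷ u)  (there (here (() ∷ _)))
  ¬00 (true ∷ u)  (there (there (here (() ∷ _))))
  ¬00 (true ∷ u)  (there (there (there i))) = ¬00 u i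

  ¬111 : ∀ {m} (u : Vec Bool m) → ¬ IsSubword (1F ∷ 1F ∷ 1F ∷ []) (0F ∷ runs u)
  ¬111 u           (here (() ∷ _))
  ¬111 []          (there (here ()))
  ¬111 (false ∷ u) (there (here (_ ∷ () ∷ _)))
  ¬111 (false ∷ u) (there (there i)) = ¬111 u i
  ¬111 (true ∷ u)  (there (here (_ ∷ _ ∷ () ∷ _)))
  ¬111 (true ∷ u)  (there (there (here (_ ∷ () ∷ _))))
  ¬111 (true ∷ u)  (there (there (there i))) = ¬111 u i

padovan⇒runs : ∀ {w} → IsPadovan w → ∃₂ λ m (u : Vec Bool m) → w ≡ 0F ∷ runs u
padovan⇒runs {w} w-padovan = from w starts-with-0 ends-with-0 no-00 no-111
  where
  open IsPadovan w-padovan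

  -- The preceding 0 stays in the hypotheses, so that an empty run appears as 00. A run cut off by
  -- the end of the word contradicts its last letter.
  go : ∀ w → last (0F ∷ w) ≡ just 0F → ¬ IsSubword (0F ∷ 0F ∷ []) (0F ∷ w) →
       ¬ IsSubword (1F ∷ 1F ∷ 1F ∷ []) (0F ∷ w) → ∃₂ λ m (u : Vec Bool m) → w ≡ runs u
  go []                 _ _   _    = 0 , [] , refl
  go (0F ∷ w)           _ ¬00 _    = contradiction (here (refl ∷ refl ∷ [])) ¬00
  go (1F ∷ [])          () _  _
  go (1F ∷ 0F ∷ w)      e ¬00 ¬111
    with m , u , refl ← go w e (λ i → ¬00 (there (there i))) (λ i → ¬111 (there (there i))) =
    suc m , false ∷ u , refl
  go (1F ∷ 1F ∷ [])     () _  _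
  go (1F ∷ 1F ∷ 0F ∷ w) e ¬00 ¬111
    with m , u , refl ← go w e (λ i → ¬00 (there (there (there i))))
                             (λ i → ¬111 (there (there (there i)))) =
    suc m , true ∷ u , refl
  go (1F ∷ 1F ∷ 1F ∷ w) _ _   ¬111 =
    contradiction (there (here (refl ∷ refl ∷ refl ∷ []))) ¬111

  from : ∀ w → head w ≡ just 0F → last w ≡ just 0F → ¬ IsSubword (0F ∷ 0F ∷ []) w →
         ¬ IsSubword (1F ∷ 1F ∷ 1F ∷ []) w → ∃₂ λ m (u : Vec Bool m) → w ≡ 0F ∷ runs u
  from (0F ∷ w) refl e ¬00 ¬111 with m , u , refl ← go w e ¬00 ¬111 = m , u , refl

-- Swaps of 01 to 10 as elementary moves.

⇝⇒swaps : ∀ {m} {u v : Vec Bool m} → u ⇝ v → Swaps01To10 (0F ∷ runs u) (0F ∷ runs v)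
-- The word begins 010110 and becomes 011010, so the exchanged 01 comes after a prefix 01.
⇝⇒swaps (here {u = u}) = 0F ∷ 1F ∷ [] , 1F ∷ 0F ∷ runs u , refl , refl
⇝⇒swaps (there {b = false} e) with p , s , eq , eq′ ← ⇝⇒swaps e =
  0F ∷ 1F ∷ p , s , cong (λ w → 0F ∷ 1F ∷ w) eq , cong (λ w → 0F ∷ 1F ∷ w) eq′
⇝⇒swaps (there {b = true}  e) with p , s , eq , eq′ ← ⇝⇒swaps e =
  0F ∷ 1F ∷ 1F ∷ p , s , cong (λ w → 0F ∷ 1F ∷ 1F ∷ w) eq , cong (λ w → 0F ∷ 1F ∷ 1F ∷ w) eq′

-- The 0 that moves is not the leading one, so it closes a run, which gains a 1 from the next run.
-- As all runs have length 1 or 2, the two lengths change from 1, 2 to 2, 1.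
swaps⇒⇝ : ∀ {m} (u v : Vec Bool m) → Swaps01To10 (0F ∷ runs u) (0F ∷ runs v) → u ⇝ v
swaps⇒⇝ u v ([] , s , eq , ())
swaps⇒⇝ u v (_ ∷ p , s , eq , eq′) = go u v p (∷-injectiveʳ eq) (∷-injectiveʳ eq′)
  where
  -- The swap is at the end of the first run; the two remainders differ by the 1 handed over.
  new-run : ∀ {m s} (u v : Vec Bool m) → runs u ≡ 1F ∷ s → runs v ≡ s →
            false ∷ u ⇝ true ∷ v
  new-run []          []          () eq′
  new-run (false ∷ u) (false ∷ v) refl ()
  new-run (false ∷ u) (true ∷ v)  refl ()
  new-run (true ∷ u)  (false ∷ v) refl eq′
    with refl ← runs-injective {u = v} {u} (∷-injectiveʳ (∷-injectiveʳ eq′)) = here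
  new-run (true ∷ u)  (true ∷ v)  refl ()

  go : ∀ {m s} (u v : Vec Bool m) p →
       runs u ≡ p ++ 0F ∷ 1F ∷ s → runs v ≡ p ++ 1F ∷ 0F ∷ s → u ⇝ v
  go []          []          []             () _
  go []          []          (_ ∷ _)        () _
  go (false ∷ u) v           []             () _
  go (true ∷ u)  v           []             () _
  go (false ∷ u) (false ∷ v) (_ ∷ [])       _  ()
  go (false ∷ u) (false ∷ v) (_ ∷ _ ∷ p)    eq eq′ =
    there (go u v p (∷-injectiveʳ (∷-injectiveʳ eq)) (∷-injectiveʳ (∷-injectiveʳ eq′)))
  go (false ∷ u) (true ∷ v)  (_ ∷ [])       eq eq′ =
    new-run u v (∷-injectiveʳ (∷-injectiveʳ eq)) (∷-injectiveʳ (∷-injectiveʳ (∷-injectiveʳ eq′)))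
  go (false ∷ u) (true ∷ v)  (_ ∷ 0F ∷ p)   _  ()
  go (false ∷ u) (true ∷ v)  (_ ∷ 1F ∷ p)   () _
  go (true ∷ u)  v           (_ ∷ [])       () _
  go (true ∷ u)  (false ∷ v) (_ ∷ 0F ∷ p)   () _
  go (true ∷ u)  (false ∷ v) (_ ∷ 1F ∷ p)   _  ()
  go (true ∷ u)  (true ∷ v)  (_ ∷ _ ∷ [])   _  ()
  go (true ∷ u)  (true ∷ v)  (_ ∷ _ ∷ _ ∷ p) eq eq′ =
    there (go u v p (∷-injectiveʳ (∷-injectiveʳ (∷-injectiveʳ eq)))
                    (∷-injectiveʳ (∷-injectiveʳ (∷-injectiveʳ eq′))))

-- Vertices as codes, and the median property.

module _ {n k : ℕ} where

  open SimpleGraph (Φ n k)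

  -- Computed from the bare word, since the irrelevant proof cannot supply a vector. `drop 1`
  -- removes the leading 0.
  code : Vertex → Vec Bool (n ∸ suc k)
  code x = unruns (n ∸ suc k) (drop 1 (value x))

  value≡runs-code : ∀ x → value x ≡ 0F ∷ runs (code x)
  -- Equality of words is decidable, so it can be recovered from the irrelevant proof.
  value≡runs-code (w , [ w-ok ]) = recompute (≡-dec _≟_ _ _) (decoded w-ok)
    where
    decoded : ∀ {w} → IsPadovan w × length w ≡ n × ones w ≡ k →
              w ≡ 0F ∷ runs (unruns (n ∸ suc k) (drop 1 w))
    decoded (w-padovan , refl , refl)
      with m , u , refl ← padovan⇒runs w-padovan
      rewrite length-runs u | m+n∸n≡m m (ones (runs u)) =
      cong (λ v → 0F ∷ runs v) (sym (unruns-runs u))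

  -- By `ones-runs` the end height is `k` minus the number of letters, hence common to all codes, as
  -- `≡-or-closer` requires.
  end-code : ∀ x → end 0 (code x) ≡ k ∸ (n ∸ suc k)
  end-code x@(_ , [ w-ok ]) = recompute (_ ≟ℕ _) (counted w-ok)
    where
    counted : IsPadovan (value x) × length (value x) ≡ n × ones (value x) ≡ k →
              end 0 (code x) ≡ k ∸ (n ∸ suc k)
    counted (_ , _ , ones≡k) = sym (trans
      (cong (_∸ (n ∸ suc k))
        (trans (sym ones≡k) (trans (cong ones (value≡runs-code x)) (ones-runs 0 (code x)))))
      (m+n∸m≡n (n ∸ suc k) _))

  -- The vertex `x` is a template: equal vector length and end height give the new word the length
  -- and number of ones of `x`.
  vertex : ∀ (x : Vertex) u → end 0 u ≡ end 0 (code x) → Vertex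
  vertex x u eq = 0F ∷ runs u , Irrelevant.map good (proof x)
    where
    ones≡ : ones (0F ∷ runs u) ≡ ones (value x)
    ones≡ = trans (trans (ones-runs 0 u) (cong (n ∸ suc k +_) eq))
      (trans (sym (ones-runs 0 (code x))) (sym (cong ones (value≡runs-code x))))

    length≡ : length (0F ∷ runs u) ≡ length (value x)
    length≡ = trans (cong suc (trans (length-runs u) (trans
        (cong (n ∸ suc k +_) (trans ones≡ (cong ones (value≡runs-code x))))
        (sym (length-runs (code x))))))
      (sym (cong length (value≡runs-code x)))

    good : IsPadovan (value x) × length (value x) ≡ n × ones (value x) ≡ k →
           IsPadovan (0F ∷ runs u) × length (0F ∷ runs u) ≡ n × ones (0F ∷ runs u) ≡ k
    good (_ , l , o) = runs-padovan u , trans length≡ l , trans ones≡ o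

  code-vertex : ∀ x u eq → code (vertex x u eq) ≡ u
  code-vertex x u eq = unruns-runs u

  code-injective : ∀ {x y} → code x ≡ code y → x ≡ y
  code-injective {x} {y} eq = value-injective
    (trans (value≡runs-code x) (trans (cong (λ u → 0F ∷ runs u) eq) (sym (value≡runs-code y))))

  swaps⇒code-⇝ : ∀ x y → Swaps01To10 (value x) (value y) → code x ⇝ code y
  swaps⇒code-⇝ x y e =
    swaps⇒⇝ _ _ (subst₂ Swaps01To10 (value≡runs-code x) (value≡runs-code y) e)

  d : Vertex → Vertex → ℕ
  d x y = dist 0 0 (code x) (code y)

  d-sym : ∀ x y → d x y ≡ d y x
  d-sym x y = dist-sym 0 0 (code x) (code y)

  d-adj : ∀ {x y} → Adj x y → d x y ≤ 1
  d-adj {x} {y} (inj₁ e) = ≤-reflexive (⇝-dist 0 (swaps⇒code-⇝ x y e))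
  d-adj {x} {y} (inj₂ e) = ≤-reflexive (trans (d-sym x y) (⇝-dist 0 (swaps⇒code-⇝ y x e)))

  closer⇒neighbour : ∀ x y → Closer 0 (code x) (code y) →
                     ∃[ x′ ] Adj x x′ × d x y ≡ suc (d x′ y)
  closer⇒neighbour x y (u , e , eq) =
    x′ , inj₁ (subst (λ w → Swaps01To10 w _) (sym (value≡runs-code x)) (⇝⇒swaps e)) ,
    trans eq (cong (λ v → suc (dist 0 0 v (code y))) (sym (code-vertex x u u-end)))
    where
    u-end = sym (⇝-end 0 e)
    x′    = vertex x u u-end

  approach : ∀ x y → x ≡ y
                   ⊎ (∃[ x′ ] Adj x x′ × d x y ≡ suc (d x′ y))
                   ⊎ (∃[ y′ ] Adj y y′ × d y x ≡ suc (d y′ x))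
  approach x y with ≡-or-closer 0 (code x) (code y) (trans (end-code x) (sym (end-code y)))
  ... | inj₁ eq       = inj₁ (code-injective eq)
  ... | inj₂ (inj₁ c) = inj₂ (inj₁ (closer⇒neighbour x y c))
  ... | inj₂ (inj₂ c) = inj₂ (inj₂ (closer⇒neighbour y x c))

  Φ-metric : GeodesicMetric (Φ n k)
  Φ-metric = record
    { d          = d
    ; d-refl     = λ x → dist-refl 0 (code x)
    ; d-sym      = d-sym
    ; d-triangle = λ x y z → dist-triangle 0 0 0 (code x) (code y) (code z)
    ; d-adj      = λ {x} {y} → d-adj {x} {y}
    ; approach   = approach
    }

  open GeodesicMetric Φ-metric using (onShortestPath⇒between; between⇒onShortestPath)

  Φ-isMedianGraph : IsMedianGraph (Φ n k)
  Φ-isMedianGraph u v w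
    -- `med 0 0 0` computes to `0`, so the median path starts at the same height as the codes.
    with x , x-median@(uxv , uxw , vxw) , x-end ← median-exists 0 0 0 (code u) (code v) (code w) =
    μ ,
    (between⇒onShortestPath (along u v uxv) ,
     between⇒onShortestPath (along u w uxw) ,
     between⇒onShortestPath (along v w vxw)) ,
    λ {y} (uyv , uyw , vyw) → code-injective (trans (code-vertex u x x-end′)
      (median-unique 0 0 0 0 (code u) (code v) (code w) x (code y) x-median
        (onShortestPath⇒between uyv , onShortestPath⇒between uyw , onShortestPath⇒between vyw)))
    where
    x-end′ : end 0 x ≡ end 0 (code u)
    x-end′ = trans x-end (trans
      (cong₂ (med (end 0 (code u)))
        (trans (end-code v) (sym (end-code u))) (trans (end-code w) (sym (end-code u))))
      (med-idem _))

    μ : Vertex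
    μ = vertex u x x-end′

    along : ∀ a b → BetweenPaths 0 0 0 (code a) x (code b) → d a μ + d μ b ≡ d a b
    along a b = subst (λ z → BetweenPaths 0 0 0 (code a) z (code b)) (sym (code-vertex u x x-end′))

theorem4p2 : ∀ (n k : ℕ) → 1 ≤ n → n / 2 ≤ k → k ≤ (2 * n ∸ 2) / 3 → IsMedianGraph (Φ n k)
theorem4p2 n k _ _ _ = Φ-isMedianGraph
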